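{- Every LSGA net is distributed.
   Context: **Petri nets.** Let $\mathrm{Act}$ be a set of visible actions, $\tau\notin\mathrm{Act}$, $\mathrm{Act}_\tau=\mathrm{Act}\cup\{\tau\}$. A multiset over $X$ is a function $A:X\to\mathbb N$; $\le,+,-$ are pointwise, $x\in A$ iff $A(x)\neq 0$, $\varnothing$ is the zero multiset, $|A|=\sum_xA(x)$, $A\restriction Y$ is restriction; multisets over different domains are extended by $0$ where needed. A (labelled) Petri net is $N=(S,T,F,M_0,\ell)$ with $S,T$ disjoint sets (places, transitions), $F:(S\times T\cup T\times S)\to\mathbb N$, initial marking $M_0:S\to\mathbb N$, labelling $\ell:T\to\mathrm{Act}_\tau$. A marking is a multiset $M\in\mathbb N^S$. For $x\in S\cup T$ the multisets ${}^\bullet x,x^\bullet$ are ${}^\bullet x(y)=F(y,x)$, $x^\bullet(y)=F(x,y)$; they extend additively to multisets. For non-empty finite $G\in\mathbb N^T$, $M[G\rangle M'$ iff ${}^\bullet G\le M$ and $M'=(M-{}^\bullet G)+G^\bullet$; $M[G\rangle$ means $\exists M'.\,M[G\rangle M'$. $[M_0\rangle$ is the smallest set of markings containing $M_0$ and closed under steps $[G\rangle$. $t\smile u$ iff $\exists M\in[M_0\rangle.\ M[\{t\}+\{u\}\rangle$ (also for $t=u$). **Distributed nets.** $N$ is *distributed* iff there is a function $D$ from $S\cup T$ to some set of locations such that (1) $s\in{}^\bullet t$ implies $D(t)=D(s)$ for $s\in S,t\in T$, and (2) $t\smile u$ implies $D(t)\neq D(u)$ for $t,u\in T$. **LSGA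 nets.** For a Petri net $N=(S,T,F,M_0,\ell)$ and $I,O\subseteq S$ with $I\cap O=\varnothing$ and $o^\bullet=\varnothing$ for all $o\in O$, the triple $(N,I,O)$ is a *component with interface* $(I,O)$. It is *sequential* iff there is $Q\subseteq S\setminus(I\cup O)$ with $|{}^\bullet t\restriction Q|=1$ and $|t^\bullet\restriction Q|=1$ for all $t\in T$, and $|M_0\restriction Q|=1$. Let $((S_k,T_k,F_k,{M_0}_k,\ell_k),I_k,O_k)$, $k\in\mathfrak K$, be components with interface such that for all $k\ne l$: $(S_k\cup T_k)\cap(S_l\cup T_l)=(I_k\cup O_k)\cap(I_l\cup O_l)$ and $I_k\cap I_l=\varnothing$. Their *asynchronous parallel composition* is $((S,T,F,M_0,\ell),I,O)$ with $S=\bigcup_kS_k$, $T=\bigcup_kT_k$, $F=\bigcup_kF_k$ (value $0$ on pairs not in the domain of any $F_k$), $M_0=\sum_k{M_0}_k$, $\ell=\bigcup_k\ell_k$, $I=\bigcup_kI_k$, $O=\bigcup_kO_k\setminus\bigcup_kI_k$. A Petri net $N$ is an *LSGA net* iff for some $I,O$, $(N,I,O)$ is the asynchronous parallel composition of a family of sequential components with interface (satisfying these conditions). -}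

module Defs where

open import Data.List.Base using (List; []; _∷_; map)
open import Data.List.Membership.Propositional renaming (_∈_ to _∈ₗ_)
open import Data.List.NonEmpty.Base using (List⁺; _∷_; toList)
open import Data.List.Relation.Unary.All using (All)
open import Data.List.Relation.Unary.Unique.Propositional using (Unique)
open import Data.Maybe.Base using (Maybe)
open import Data.Nat.Base using (ℕ; _+_; _∸_; _≤_)
open import Data.Nat.ListAction using (sum)
open import Data.Product.Base using (∃-syntax; _×_)
open import Data.Sum.Base using (_⊎_; inj₁; inj₂)
open import Level using (0ℓ)
open import Relation.Binary.Bundles using (Setoid)
open import Relation.Binary.PropositionalEquality using (_≡_; _≢_)
open import Relation.Nullary using (¬_)
open import Relation.Unary
  using (Pred; _∈_; _∉_; _⊆_; _≐_; _∩_; _∪_; _∖_; _⊥_; ⋃; U)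

-- All sets of places and transitions are subsets of one carrier X, so that
-- different nets can share elements.  A multiset over a subset of X is a
-- function on X, vanishing outside that subset.

Multiset : Set → Set
Multiset X = X → ℕ

infix 4 _∈ᵐ_ _≤ᵐ_

_∈ᵐ_ : ∀ {X} → X → Multiset X → Set
x ∈ᵐ A = A x ≢ 0

_≤ᵐ_ : ∀ {X} → Multiset X → Multiset X → Set
A ≤ᵐ B = ∀ x → A x ≤ B x

-- "The sum of f over P is the natural number n", for a possibly infinite P:
-- f has finite support in P, and its values there add up to n.
record SumOver {A : Set} (P : Pred A 0ℓ) (f : A → ℕ) (n : ℕ) : Set where
  field
    support  : List A
    unique   : Unique support
    inside   : All P support
    complete : ∀ {x} → x ∈ P → f x ≢ 0 → x ∈ₗ support
    total    : sum (map f support) ≡ n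

∣_↾_∣≡_ : ∀ {X} → Multiset X → Pred X 0ℓ → ℕ → Set
∣ A ↾ Q ∣≡ n = SumOver Q A n

-- τ is `nothing`.
Actτ : Set → Set
Actτ Act = Maybe Act

-- The irrelevant argument of the labelling makes it a function on the subset
-- of transitions.
record Net (Act X : Set) : Set₁ where
  field
    S         : Pred X 0ℓ
    T         : Pred X 0ℓ
    S⊥T       : S ⊥ T
    F         : X → X → ℕ
    F-support : ∀ {x y} → F x y ≢ 0 → (x ∈ S × y ∈ T) ⊎ (x ∈ T × y ∈ S)
    M₀         : Multiset X
    M₀-support : ∀ {x} → x ∈ᵐ M₀ → x ∈ S
    label     : (t : X) → .(t ∈ T) → Actτ Act

  infix 30 •_ _•

  •_ : X → Multiset X
  (• x) y = F y x

  _• : X → Multiset X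
  (x •) y = F x y

  -- A non-empty finite multiset G of transitions is given by a non-empty list,
  -- with repetitions.  These are the additive extensions of • to such G.
  pre : List⁺ X → Multiset X
  pre G y = sum (map (λ t → (• t) y) (toList G))

  post : List⁺ X → Multiset X
  post G y = sum (map (λ t → (t •) y) (toList G))

  infix 4 _[_⟩_

  record _[_⟩_ (M : Multiset X) (G : List⁺ X) (M′ : Multiset X) : Set where
    field
      transitions : All T (toList G)
      enabled     : pre G ≤ᵐ M
      result      : ∀ x → M′ x ≡ (M x ∸ pre G x) + post G x

  data Reachable : Multiset X → Set where
    initial : Reachable M₀
    step    : ∀ {M G M′} → Reachable M → M [ G ⟩ M′ → Reachable M′

  infix 4 _⌣_

  _⌣_ : X → X → Set
  t ⌣ u = ∃[ M ] Reachable M × ∃[ M′ ] M [ t ∷ u ∷ [] ⟩ M′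

-- The set of locations is a setoid, because the theory has no quotients.
record IsDistributed {Act X : Set} (N : Net Act X) : Set₁ where
  open Net N
  field
    Location : Setoid 0ℓ 0ℓ
  open Setoid Location using (Carrier; _≈_)
  field
    D : (x : X) → .(x ∈ S ∪ T) → Carrier
    co-located : ∀ {s t} (s∈S : s ∈ S) (t∈T : t ∈ T) →
                 s ∈ᵐ • t → D t (inj₂ t∈T) ≈ D s (inj₁ s∈S)
    separated  : ∀ {t u} (t∈T : t ∈ T) (u∈T : u ∈ T) →
                 t ⌣ u → ¬ (D t (inj₂ t∈T) ≈ D u (inj₂ u∈T))

record Component (Act X : Set) : Set₁ where
  field
    net : Net Act X
  open Net net public
  field
    I   : Pred X 0ℓ
    O   : Pred X 0ℓ
    I⊆S : I ⊆ S
    O⊆S : O ⊆ S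
    I⊥O : I ⊥ O
    O•≡∅ : ∀ {o} → o ∈ O → ∀ x → (o •) x ≡ 0

record IsSequential {Act X : Set} (C : Component Act X) : Set₁ where
  open Component C
  field
    Q        : Pred X 0ℓ
    Q⊆S∖I∪O  : Q ⊆ S ∖ (I ∪ O)
    ∣•t↾Q∣≡1 : ∀ {t} → t ∈ T → ∣ • t ↾ Q ∣≡ 1
    ∣t•↾Q∣≡1 : ∀ {t} → t ∈ T → ∣ t • ↾ Q ∣≡ 1
    ∣M₀↾Q∣≡1 : ∣ M₀ ↾ Q ∣≡ 1

module _ {Act X K : Set} (C : K → Component Act X) where
  private module C k = Component (C k)

  record Composable : Set where
    field
      shared : ∀ {k l} → k ≢ l →
               (C.S k ∪ C.T k) ∩ (C.S l ∪ C.T l) ≐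
               (C.I k ∪ C.O k) ∩ (C.I l ∪ C.O l)
      inputs-disjoint : ∀ {k l} → k ≢ l → C.I k ⊥ C.I l

  FlowDomain : K → X → X → Set
  FlowDomain k x y = (x ∈ C.S k × y ∈ C.T k) ⊎ (x ∈ C.T k × y ∈ C.S k)

  -- M₀-sum also asserts that the sum of the initial markings is finite at
  -- every place; otherwise it is no marking and there is no composition.
  record IsParallelComposition (N : Net Act X) (I O : Pred X 0ℓ) : Set where
    private module N = Net N
    field
      S-union     : N.S ≐ ⋃ K C.S
      T-union     : N.T ≐ ⋃ K C.T
      F-union     : ∀ k {x y} → FlowDomain k x y → N.F x y ≡ C.F k x y
      F-outside   : ∀ {x y} → (∀ k → ¬ FlowDomain k x y) → N.F x y ≡ 0
      M₀-sum      : ∀ x → SumOver U (λ k → C.M₀ k x) (N.M₀ x)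
      label-union : ∀ k {t} (t∈T : t ∈ N.T) (t∈Tₖ : t ∈ C.T k) →
                    N.label t t∈T ≡ C.label k t t∈Tₖ
      I-union     : I ≐ ⋃ K C.I
      O-union     : O ≐ ⋃ K C.O ∖ ⋃ K C.I

record IsLSGA {Act X : Set} (N : Net Act X) : Set₁ where
  field
    K           : Set
    C           : K → Component Act X
    sequential  : ∀ k → IsSequential (C k)
    composable  : Composable C
    I O         : Pred X 0ℓ
    composition : IsParallelComposition C N I O

{-# OPTIONS --safe #-}

-- The locations are the components.  A place is never an input of transitions
-- of two different components: a shared place is an input or output place of
-- each component sharing it, output places have no posttransitions, and distinct
-- components have disjoint inputs.  Within a component all transitions are
-- mutually exclusive, since Q carries exactly one token in every reachable
-- marking and each transition consumes a token from Q.  Equality of components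
-- is not decidable, so cases on it are only ever distinguished under ¬ ¬.

module Submission where

open import Defs
open import Data.List.Base using (List; []; _∷_; map)
open import Data.List.Membership.Propositional renaming (_∈_ to _∈ₗ_)
open import Data.List.Relation.Unary.All using (All; []; _∷_; lookup)
open import Data.List.Relation.Unary.AllPairs using (_∷_)
open import Data.List.Relation.Unary.Any using (here; there)
open import Data.List.Relation.Unary.Unique.Propositional using (Unique)
open import Data.Nat.Base using (ℕ; _+_; _∸_; _≤_)
open import Data.Nat.ListAction using (sum)
open import Data.Nat.Properties using
  ( _≟_; +-identityʳ; m+n≡0⇒m≡0; m+n≡0⇒n≡0; suc-injective; 1+n≰n; m+n≤o⇒m≤o; m+n≤o⇒n≤o
  ; m≤n⇒m≤o+n; m≤n⇒m∸n≡0; ≤-reflexive; ≤-trans )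
open import Data.Product.Base using (∃-syntax; _×_; _,_; proj₁; proj₂)
open import Data.Sum.Base using (_⊎_; inj₁; inj₂)
open import Level using (0ℓ)
open import Relation.Binary.Construct.On as On using ()
open import Relation.Binary.PropositionalEquality
  using (_≡_; _≢_; refl; sym; trans; cong; cong₂; subst; subst₂; ≢-sym)
open import Relation.Nullary using (¬_; yes; no; contradiction)
open import Relation.Nullary.Decidable using (decidable-stable; ¬¬-excluded-middle)
open import Relation.Unary using (Pred; _∈_; _∪_; U)
open import Relation.Unary.Relation.Binary.Equality using (≐-setoid)

module _ {A : Set} (f : A → ℕ) where

  sum-zero : ∀ xs → (∀ {x} → x ∈ₗ xs → f x ≡ 0) → sum (map f xs) ≡ 0
  sum-zero []       f≡0 = refl
  sum-zero (x ∷ xs) f≡0 = cong₂ _+_ (f≡0 (here refl)) (sum-zero xs (λ p → f≡0 (there p)))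

  sum≡0⇒zero : ∀ {xs} → sum (map f xs) ≡ 0 → ∀ {x} → x ∈ₗ xs → f x ≡ 0
  sum≡0⇒zero {x ∷ _} eq (here refl) = m+n≡0⇒m≡0 (f x) eq
  sum≡0⇒zero {x ∷ _} eq (there p)   = sum≡0⇒zero (m+n≡0⇒n≡0 (f x) eq) p

  sum-single : ∀ {xs a} → Unique xs → a ∈ₗ xs → (∀ {x} → a ≢ x → f x ≡ 0) →
               sum (map f xs) ≡ f a
  sum-single {x ∷ xs} (x∉ ∷ _) (here refl) f≡0 =
    trans (cong (f x +_) (sum-zero xs (λ p → f≡0 (lookup x∉ p)))) (+-identityʳ (f x))
  sum-single {x ∷ xs} (x∉ ∷ u) (there p) f≡0 =
    cong₂ _+_ (f≡0 (λ { refl → lookup x∉ p refl })) (sum-single u p f≡0)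

  SumOver-single : ∀ {n a} → SumOver U f n → (∀ {x} → a ≢ x → f x ≡ 0) → n ≡ f a
  SumOver-single {a = a} Σf f≡0 with f a ≟ 0
  ... | no  fa≢0 = trans (sym total) (sum-single unique (complete _ fa≢0) f≡0)
    where open SumOver Σf
  ... | yes fa≡0 = trans (sym total) (trans (sum-zero support λ {x} _ → vanish x) (sym fa≡0))
    where
      open SumOver Σf
      vanish : ∀ x → f x ≡ 0
      vanish x with f x ≟ 0
      ... | yes fx≡0 = fx≡0
      -- As `f a` is 0 and `f x` is not, `a ≢ x` follows without deciding equality on `A`.
      ... | no  fx≢0 = f≡0 (λ { refl → fx≢0 fa≡0 })

-- A list-free form of `SumOver Q A 1`: on `Q`, `A` is the indicator of `q`. It transfers along
-- pointwise equality on `Q`.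
record Token {X : Set} (Q : Pred X 0ℓ) (A : Multiset X) (q : X) : Set where
  field
    place : q ∈ Q
    one   : A q ≡ 1
    only  : ∀ {x} → x ∈ Q → x ∈ᵐ A → x ≡ q

open Token

module _ {X : Set} {Q : Pred X 0ℓ} where

  SumOver-1⇒Token : ∀ {A} → SumOver Q A 1 → ∃[ q ] Token Q A q
  SumOver-1⇒Token {A} ΣA =
    let q , q∈Q , Aq≡1 , only-q = locate inside total
    in q , record { place = q∈Q ; one = Aq≡1 ; only = λ x∈Q Ax≢0 → only-q (complete x∈Q Ax≢0) Ax≢0 }
    where
      open SumOver ΣA
      locate : ∀ {xs} → All Q xs → sum (map A xs) ≡ 1 →
               ∃[ q ] q ∈ Q × A q ≡ 1 × (∀ {x} → x ∈ₗ xs → x ∈ᵐ A → x ≡ q)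
      locate {x ∷ xs} (x∈Q ∷ xs⊆Q) eq with A x in Ax
      ... | 0 = let q , q∈Q , Aq≡1 , only-q = locate xs⊆Q eq
                in q , q∈Q , Aq≡1 , λ { (here refl) Ax≢0 → contradiction Ax Ax≢0
                                      ; (there p) → only-q p }
      -- Values from 2 on are excluded by `eq`; for 1, the rest of the list sums to 0.
      ... | 1 = x , x∈Q , Ax , λ { (here refl) _ → refl
                                 ; (there p) Ay≢0 → contradiction (sum≡0⇒zero A (suc-injective eq) p) Ay≢0 }

  Token-resp : ∀ {A B q} → (∀ {x} → x ∈ Q → B x ≡ A x) → Token Q A q → Token Q B q
  Token-resp B≗A a = record
    { place = place a
    ; one   = trans (B≗A (place a)) (one a)
    ; only  = λ x∈Q Bx≢0 → only a x∈Q (λ Ax≡0 → Bx≢0 (trans (B≗A x∈Q) Ax≡0))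
    }

  -- The cases are on values, as `x ≡ q` need not be decidable: a nonzero value forces `x ≡ q`,
  -- where both multisets are 1.
  Token-unique : ∀ {A B q} → Token Q A q → Token Q B q → ∀ {x} → x ∈ Q → A x ≡ B x
  Token-unique {A} {B} a b {x} x∈Q with A x ≟ 0 | B x ≟ 0
  ... | yes Ax≡0 | yes Bx≡0 = trans Ax≡0 (sym Bx≡0)
  ... | no  Ax≢0 | _ with refl ← only a x∈Q Ax≢0 = trans (one a) (sym (one b))
  ... | yes _ | no Bx≢0 with refl ← only b x∈Q Bx≢0 = trans (one a) (sym (one b))

  Token-≤ : ∀ {A B p q} → Token Q A p → Token Q B q → (∀ {x} → x ∈ Q → A x ≤ B x) → p ≡ q
  Token-≤ {B = B} {p} a b A≤B =
    only b (place a) (λ Bp≡0 → 1+n≰n (subst₂ _≤_ (one a) Bp≡0 (A≤B (place a))))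

  -- By `Token-≤` all three tokens share one place, where the left side is 2 and `C` only 1.
  two-tokens-≰-one : ∀ {A B C p q r} → Token Q A p → Token Q B q → Token Q C r →
                     ¬ (∀ {x} → x ∈ Q → A x + B x ≤ C x)
  two-tokens-≰-one a b c A+B≤C
    with refl ← Token-≤ a c (λ x∈Q → m+n≤o⇒m≤o _ (A+B≤C x∈Q))
       | refl ← Token-≤ b c (λ x∈Q → m+n≤o⇒n≤o _ (A+B≤C x∈Q))
    = 1+n≰n (subst₂ _≤_ (cong₂ _+_ (one a) (one b)) (one c) (A+B≤C (place c)))

module _ {Act X : Set} (N : Net Act X) (lsga : IsLSGA N) where

  open Net N
  open IsLSGA lsga using (K; C; sequential; composable; composition)
  open Composable composable
  open IsParallelComposition composition
  private
    module C k = Component (C k)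
    module Seq k = IsSequential (sequential k)

  -- A shared element lies in an interface and is thus a place, against `S⊥T`.
  transition-private : ∀ {k l t} → t ∈ C.T k → t ∈ C.S l ∪ C.T l → ¬ ¬ (k ≡ l)
  transition-private {k} t∈Tₖ t∈Cₗ k≢l with proj₁ (proj₁ (shared k≢l) (inj₂ t∈Tₖ , t∈Cₗ))
  ... | inj₁ t∈I = C.S⊥T k (C.I⊆S k t∈I , t∈Tₖ)
  ... | inj₂ t∈O = C.S⊥T k (C.O⊆S k t∈O , t∈Tₖ)

  control-private : ∀ {k l x} → x ∈ Seq.Q k → x ∈ C.S l ∪ C.T l → ¬ ¬ (k ≡ l)
  control-private {k} x∈Q x∈Cₗ k≢l =
    let x∈S , x∉I∪O = Seq.Q⊆S∖I∪O k x∈Q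
    in x∉I∪O (proj₁ (proj₁ (shared k≢l) (inj₁ x∈S , x∈Cₗ)))

  -- Any component with `(s , t)` in its flow domain contains `t`, so it cannot differ from `k`.
  -- Were the goal false, no such component could exist, and `F-outside` would make the arc weight
  -- 0.
  flow-owner : ∀ {k s t} → t ∈ C.T k → s ∈ᵐ • t → ¬ ¬ (s ∈ C.S k × C.F k s t ≢ 0)
  flow-owner {s = s} {t} t∈Tₖ st≢0 ¬goal = st≢0 (F-outside λ
    { l (inj₁ (s∈S , t∈T)) → transition-private t∈Tₖ (inj₂ t∈T) λ
        { refl → ¬goal (s∈S , λ F≡0 → st≢0 (trans (F-union l (inj₁ (s∈S , t∈T))) F≡0)) }
    ; l (inj₂ (s∈T , t∈S)) → transition-private t∈Tₖ (inj₁ t∈S) λ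
        { refl → C.S⊥T l (t∈S , t∈Tₖ) } })

  preplace-private : ∀ {k l s t u} → t ∈ C.T k → u ∈ C.T l → s ∈ᵐ • t → s ∈ᵐ • u → ¬ ¬ (k ≡ l)
  preplace-private {k} {l} t∈Tₖ u∈Tₗ st su k≢l =
    flow-owner t∈Tₖ st λ { (s∈Sₖ , Fₖ≢0) →
    flow-owner u∈Tₗ su λ { (s∈Sₗ , Fₗ≢0) →
    case-shared Fₖ≢0 Fₗ≢0 (proj₁ (shared k≢l) (inj₁ s∈Sₖ , inj₁ s∈Sₗ)) }}
    where
      case-shared : ∀ {s t u} → C.F k s t ≢ 0 → C.F l s u ≢ 0 →
                    ¬ (s ∈ C.I k ∪ C.O k × s ∈ C.I l ∪ C.O l)
      case-shared Fₖ≢0 Fₗ≢0 (inj₂ s∈Oₖ , _)         = Fₖ≢0 (C.O•≡∅ k s∈Oₖ _)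
      case-shared Fₖ≢0 Fₗ≢0 (_         , inj₂ s∈Oₗ) = Fₗ≢0 (C.O•≡∅ l s∈Oₗ _)
      case-shared Fₖ≢0 Fₗ≢0 (inj₁ s∈Iₖ , inj₁ s∈Iₗ) = inputs-disjoint k≢l (s∈Iₖ , s∈Iₗ)

  module _ (k : K) where

    open Seq k using (Q; Q⊆S∖I∪O; ∣•t↾Q∣≡1; ∣t•↾Q∣≡1; ∣M₀↾Q∣≡1)

    •-token : ∀ {t} → t ∈ C.T k → ∃[ q ] Token Q (• t) q
    •-token t∈Tₖ =
      let q , tok = SumOver-1⇒Token (∣•t↾Q∣≡1 t∈Tₖ)
      in q , Token-resp (λ x∈Q → F-union k (inj₁ (proj₁ (Q⊆S∖I∪O x∈Q) , t∈Tₖ))) tok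

    t•-token : ∀ {t} → t ∈ C.T k → ∃[ q ] Token Q (t •) q
    t•-token t∈Tₖ =
      let q , tok = SumOver-1⇒Token (∣t•↾Q∣≡1 t∈Tₖ)
      in q , Token-resp (λ x∈Q → F-union k (inj₂ (t∈Tₖ , proj₁ (Q⊆S∖I∪O x∈Q)))) tok

    M₀-token : ∃[ q ] Token Q M₀ q
    M₀-token =
      let q , tok = SumOver-1⇒Token ∣M₀↾Q∣≡1
      -- Only component `k` can mark a place of its `Q`, so the sum of initial markings reduces to
      -- one summand there.
      in q , Token-resp (λ {x} x∈Q → SumOver-single _ (M₀-sum x) (absent x∈Q)) tok
      where
        absent : ∀ {x} → x ∈ Q → ∀ {l} → k ≢ l → C.M₀ l x ≡ 0
        absent x∈Q {l} k≢l = decidable-stable (_ ≟ 0) λ M₀x≢0 →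
          control-private x∈Q (inj₁ (C.M₀-support l M₀x≢0)) k≢l

    -- A component whose flow domain holds the pair would have to be `k`, because of `x`, and `l`,
    -- because of `t`.
    foreign-• : ∀ {l t} → t ∈ C.T l → k ≢ l → ∀ {x} → x ∈ Q → (• t) x ≡ 0
    foreign-• t∈Tₗ k≢l x∈Q = F-outside λ
      { m (inj₁ (x∈S , t∈T)) → control-private x∈Q (inj₁ x∈S) λ
          { refl → transition-private t∈T (inj₂ t∈Tₗ) k≢l }
      ; m (inj₂ (x∈T , t∈S)) → control-private x∈Q (inj₂ x∈T) λ
          { refl → transition-private t∈Tₗ (inj₁ t∈S) (≢-sym k≢l) } }

    foreign-t• : ∀ {l t} → t ∈ C.T l → k ≢ l → ∀ {x} → x ∈ Q → (t •) x ≡ 0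
    foreign-t• t∈Tₗ k≢l x∈Q = F-outside λ
      { m (inj₁ (t∈S , x∈T)) → control-private x∈Q (inj₂ x∈T) λ
          { refl → transition-private t∈Tₗ (inj₁ t∈S) (≢-sym k≢l) }
      ; m (inj₂ (t∈T , x∈S)) → control-private x∈Q (inj₁ x∈S) λ
          { refl → transition-private t∈T (inj₂ t∈Tₗ) k≢l } }

    -- Defined on possibly empty lists, so that induction over a step can start at `[]`.
    pre* post* : List X → Multiset X
    pre*  G y = sum (map (λ t → (• t) y) G)
    post* G y = sum (map (λ t → (t •) y) G)

    -- How often transitions of component k, with multiplicity, occur in a step.
    data Participation (G : List X) : Set where
      none    : (∀ {x} → x ∈ Q → pre* G x ≡ 0) →
                (∀ {x} → x ∈ Q → post* G x ≡ 0) → Participation G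
      single  : ∀ {t} → t ∈ C.T k → (∀ {x} → x ∈ Q → pre* G x ≡ (• t) x) →
                (∀ {x} → x ∈ Q → post* G x ≡ (t •) x) → Participation G
      several : ∀ {t u} → t ∈ C.T k → u ∈ C.T k →
                (∀ {x} → x ∈ Q → (• t) x + (• u) x ≤ pre* G x) → Participation G

    skip : ∀ {l t G} → t ∈ C.T l → k ≢ l → Participation G → Participation (t ∷ G)
    skip t∈T k≢l (none pre≡ post≡) =
      none (λ x∈Q → cong₂ _+_ (foreign-• t∈T k≢l x∈Q) (pre≡ x∈Q))
           (λ x∈Q → cong₂ _+_ (foreign-t• t∈T k≢l x∈Q) (post≡ x∈Q))
    skip t∈T k≢l (single u∈T pre≡ post≡) =
      single u∈T (λ x∈Q → cong₂ _+_ (foreign-• t∈T k≢l x∈Q) (pre≡ x∈Q))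
                 (λ x∈Q → cong₂ _+_ (foreign-t• t∈T k≢l x∈Q) (post≡ x∈Q))
    skip t∈T k≢l (several u∈T v∈T ≤pre) = several u∈T v∈T (λ x∈Q → m≤n⇒m≤o+n _ (≤pre x∈Q))

    join : ∀ {t G} → t ∈ C.T k → Participation G → Participation (t ∷ G)
    join t∈T (none pre≡ post≡) =
      single t∈T (λ x∈Q → trans (cong (_ +_) (pre≡ x∈Q)) (+-identityʳ _))
                 (λ x∈Q → trans (cong (_ +_) (post≡ x∈Q)) (+-identityʳ _))
    -- From two participants on, a lower bound suffices: it already contradicts enabledness.
    join t∈T (single u∈T pre≡ _) =
      several t∈T u∈T (λ x∈Q → ≤-reflexive (cong (_ +_) (sym (pre≡ x∈Q))))
    join t∈T (several u∈T v∈T ≤pre) = several u∈T v∈T (λ x∈Q → m≤n⇒m≤o+n _ (≤pre x∈Q))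

    participation : ∀ {G} → All T G → ¬ ¬ Participation G
    participation []          ¬part = ¬part (none (λ _ → refl) (λ _ → refl))
    participation (t∈T ∷ G⊆T) ¬part with l , t∈Tₗ ← proj₁ T-union t∈T =
      participation G⊆T λ part → ¬¬-excluded-middle {A = k ≡ l} λ
        { (yes refl) → ¬part (join t∈Tₗ part)
        ; (no k≢l)   → ¬part (skip t∈Tₗ k≢l part) }

    -- With no participant the marking of `Q` is unchanged, a single one moves the token, and
    -- several would need two tokens.
    step-token : ∀ {M G M′ q} → Token Q M q → M [ G ⟩ M′ → ¬ ¬ (∃[ q′ ] Token Q M′ q′)
    step-token {M} {G} {M′} tok fire ¬tok = participation transitions λ
      { (none pre≡0 post≡0) → ¬tok (_ , Token-resp
          (λ {x} x∈Q → trans (result x) (trans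
            (cong₂ (λ m n → (M x ∸ m) + n) (pre≡0 x∈Q) (post≡0 x∈Q)) (+-identityʳ (M x))))
          tok)
      ; (single t∈T pre≡ post≡) →
          let p , •tok  = •-token t∈T
              r , tok•  = t•-token t∈T
              -- Enabledness forces `t` to consume the very token of `M`. So `M` and `• t` agree on
              -- `Q`, `∸` leaves 0, and the new token is that of `t •`.
              p≡q       = Token-≤ •tok tok (λ {x} x∈Q → ≤-trans (≤-reflexive (sym (pre≡ x∈Q))) (enabled x))
              M≗•t      = Token-unique tok (subst (Token Q _) p≡q •tok)
          in ¬tok (r , Token-resp
            (λ {x} x∈Q → trans (result x) (cong₂ _+_
              (m≤n⇒m∸n≡0 (≤-reflexive (trans (M≗•t x∈Q) (sym (pre≡ x∈Q)))))
              (post≡ x∈Q)))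
            tok•)
      ; (several t∈T u∈T ≤pre) →
          two-tokens-≰-one (proj₂ (•-token t∈T)) (proj₂ (•-token u∈T)) tok
            (λ {x} x∈Q → ≤-trans (≤pre x∈Q) (enabled x)) }
      where open _[_⟩_ fire

    reachable-token : ∀ {M} → Reachable M → ¬ ¬ (∃[ q ] Token Q M q)
    reachable-token initial           ¬tok = ¬tok M₀-token
    reachable-token (step reach fire) ¬tok =
      reachable-token reach λ (_ , tok) → step-token tok fire ¬tok

    mutually-exclusive : ∀ {t u} → t ∈ C.T k → u ∈ C.T k → ¬ (t ⌣ u)
    mutually-exclusive {t} t∈T u∈T (M , reach , M′ , fire) = reachable-token reach λ (_ , tok) →
      two-tokens-≰-one (proj₂ (•-token t∈T)) (proj₂ (•-token u∈T)) tok
        -- The list sum in `pre` ends in `+ 0`.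
        (λ {x} x∈Q → ≤-trans (≤-reflexive (cong ((• t) x +_) (sym (+-identityʳ _))))
                             (_[_⟩_.enabled fire x))

  -- A place is owned by the component of its posttransitions, of which there is
  -- at most one; places without posttransitions have no owner at all and may
  -- share one location.
  Owner : X → Pred K 0ℓ
  Owner x k = ¬ ¬ (∃[ t ] t ∈ C.T k × (x ≡ t ⊎ x ∈ᵐ • t))

  ∈T⇒Owner : ∀ {k t} → t ∈ C.T k → k ∈ Owner t
  ∈T⇒Owner t∈Tₖ ¬own = ¬own (_ , t∈Tₖ , inj₁ refl)

  -- By `S⊥T` a transition is no preplace, which leaves the first alternative in `Owner`.
  Owner⇒∈T : ∀ {k t} → t ∈ T → k ∈ Owner t → ¬ ¬ (t ∈ C.T k)
  Owner⇒∈T t∈T own t∉Tₖ = own λ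
    { (_ , t∈Tₖ , inj₁ refl) → t∉Tₖ t∈Tₖ
    ; (u , u∈Tₖ , inj₂ tu≢0) → no-flow (F-support tu≢0) (proj₂ T-union (_ , u∈Tₖ)) }
    where
      no-flow : ∀ {u} → (_ ∈ S × u ∈ T) ⊎ (_ ∈ T × u ∈ S) → ¬ (u ∈ T)
      no-flow (inj₁ (t∈S , _)) _   = S⊥T (t∈S , t∈T)
      no-flow (inj₂ (_ , u∈S)) u∈T = S⊥T (u∈S , u∈T)

  distributed : IsDistributed N
  distributed = record
    -- Elements of `X` serve as locations, identified when they have the same owners; no owner has
    -- to be chosen. The double negation in `Owner` lets facts known only under `¬ ¬` prove these
    -- inclusions.
    { Location   = On.setoid (≐-setoid K 0ℓ) Owner
    ; D          = λ x _ → x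
    ; co-located = λ s∈S t∈T st≢0 →
        (λ own ¬own → Owner⇒∈T t∈T own λ t∈Tₖ → ¬own (_ , t∈Tₖ , inj₂ st≢0)) ,
        (λ own ¬own → own λ
          { (_ , s∈Tₖ , inj₁ refl) → S⊥T (s∈S , proj₂ T-union (_ , s∈Tₖ))
          -- Both `u` and `t` consume from `s`, so their components cannot differ.
          ; (u , u∈Tₖ , inj₂ su≢0) →
              let l , t∈Tₗ = proj₁ T-union t∈T
              in preplace-private u∈Tₖ t∈Tₗ su≢0 st≢0 λ { refl → ∈T⇒Owner t∈Tₗ ¬own } })
    ; separated  = λ t∈T u∈T t⌣u (Dt⊆Du , _) →
        -- Equal owners would put `u` into a component of `t`.
        let k , t∈Tₖ = proj₁ T-union t∈T
        in Owner⇒∈T u∈T (Dt⊆Du (∈T⇒Owner t∈Tₖ)) λ u∈Tₖ → mutually-exclusive k t∈Tₖ u∈Tₖ t⌣u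
    }

corollary1 : {Act X : Set} (N : Net Act X) → IsLSGA N → IsDistributed N
corollary1 = distributed
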